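{- There exists an absolute constant $C>0$ such that for all integers $n,t\geq 2$, $\log_2 A(t,n)\leq C\cdot \alpha(t,n)$.
   Context: For an integer $t\geq 2$ write $[t]=\{0,1,\dots,t-1\}$. The hypergrid $[t]^n$ is the poset on $[t]^n$ with the coordinate-wise order: $x\preceq y$ iff $x(i)\leq y(i)$ for all $i$. $\alpha(t,n)$ denotes the maximum size of an antichain in $[t]^n$, and $A(t,n)$ the number of antichains of $[t]^n$. -}

module Defs where

open import Data.Nat using (ℕ; zero; suc; _⊔_)
open import Data.Fin using (Fin) renaming (_≤_ to _≤F_; _≤?_ to _≤F?_)
open import Data.Fin.Properties using () renaming (_≟_ to _≟F_)
open import Data.List using (List; []; _∷_; map; concatMap; length; filter; foldr; _++_; allFin)
open import Data.List.Relation.Unary.All using (All; all?)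
open import Data.Vec using (Vec; []; _∷_)
open import Data.Vec.Properties using (≡-dec)
open import Data.Vec.Relation.Binary.Pointwise.Inductive using (Pointwise) renaming (decidable to pw-dec)
open import Relation.Nullary using (Dec)
open import Relation.Nullary.Decidable using (_→-dec_)
open import Relation.Binary.PropositionalEquality using (_≡_)

Point : ℕ → ℕ → Set
Point t n = Vec (Fin t) n

_≼_ : ∀ {t n} → Point t n → Point t n → Set
x ≼ y = Pointwise _≤F_ x y

_≼?_ : ∀ {t n} (x y : Point t n) → Dec (x ≼ y)
x ≼? y = pw-dec _≤F?_ x y

points : (t n : ℕ) → List (Point t n)
points t zero = [] ∷ []
points t (suc n) = concatMap (λ i → map (i ∷_) (points t n)) (allFin t)

-- All subsets of a list (as sublists); applied to a duplicate-free list,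
-- this enumerates each subset exactly once.
sublists : ∀ {a} {A : Set a} → List A → List (List A)
sublists [] = [] ∷ []
sublists (x ∷ xs) = let r = sublists xs in r ++ map (x ∷_) r

IsAntichain : ∀ {t n} → List (Point t n) → Set
IsAntichain S = All (λ x → All (λ y → x ≼ y → x ≡ y) S) S

isAntichain? : ∀ {t n} (S : List (Point t n)) → Dec (IsAntichain S)
isAntichain? S = all? (λ x → all? (λ y → (x ≼? y) →-dec (≡-dec _≟F_ x y)) S) S

antichains : (t n : ℕ) → List (List (Point t n))
antichains t n = filter isAntichain? (sublists (points t n))

A : ℕ → ℕ → ℕ
A t n = length (antichains t n)

α : ℕ → ℕ → ℕ
α t n = foldr _⊔_ 0 (map length (antichains t n))

{-# OPTIONS --safe #-}

-- Write n = 2a or n = 2a + 1, and split [t]ᵃ into M symmetric chains, where M is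
-- the size of its middle level. An antichain is determined by the down-set it
-- generates, and a down-set meets the product of two chains of lengths p and q in a
-- staircase, which p + q bits describe. Summing over all pairs of chains gives
-- log₂ A(t,2a) ≤ 2 M tᵃ, and log₂ A(t,2a+1) ≤ 2 M tᵃ⁺¹ by slicing off one coordinate.
-- The level sizes f of [t]ᵃ form a symmetric log-concave sequence, so f ≥ M / 2 on an
-- interval of length K next to the middle with tᵃ ≤ 4 K M. The level of rank a (t − 1)
-- of [t]²ᵃ has size ∑ f(x)², at least of order K M² and hence of order M tᵃ;
-- the odd case gains a factor t in the same way.

module Submission where

open import Defs
open import Data.Bool using (Bool; true; false; if_then_else_)
open import Data.Empty using (⊥)
open import Data.Fin using (Fin; combine; toℕ) renaming (zero to fzero; suc to fsuc; _≤_ to _≤F_)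
open import Data.Fin.Properties using (combine-injective; injective⇒≤; toℕ-injective) renaming (≤-refl to ≤F-refl; ≤-trans to ≤F-trans)
open import Data.List using (List; []; _∷_; _++_; _∷ʳ_; map; concat; concatMap; length; lookup; filter; foldr; reverse; allFin; tabulate; downFrom; upTo; applyUpTo; cartesianProductWith)
open import Data.List.Membership.Propositional using (_∈_; find; lose)
open import Data.List.Membership.Propositional.Properties using (∈-++⁺ˡ; ∈-++⁺ʳ; ∈-++⁻; ∈-map⁺; ∈-map⁻; ∈-filter⁺; ∈-filter⁻; ∈-lookup; ∈-allFin; ∈-concat⁻′; ∈-concat⁺′)
open import Data.List.Properties using (++-assoc; map-++; map-∘; map-cong; map-tabulate; unfold-reverse; reverse-map; reverse-downFrom; reverse-involutive; concat-++; filter-accept; filter-reject; length-map; length-++; length-reverse; length-tabulate; cartesianProductWith-zeroʳ; cartesianProductWith-distribʳ-++; ∷-injectiveˡ; ∷-injectiveʳ)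
open import Data.List.Relation.Binary.Permutation.Propositional using (_↭_; ↭-refl; ↭-reflexive; ↭-sym; ↭-trans; prep; module PermutationReasoning)
open import Data.List.Relation.Binary.Permutation.Propositional.Properties using (++⁺; ++⁺ˡ; ↭-reverse; map⁺; ↭-length; All-resp-↭; ∈-resp-↭; shifts)
open import Data.List.Relation.Binary.Subset.Propositional using (_⊆_)
open import Data.List.Relation.Unary.All as All using (All; []; _∷_)
import Data.List.Relation.Unary.All.Properties as All
open import Data.List.Relation.Unary.AllPairs as AllPairs using (AllPairs; []; _∷_)
import Data.List.Relation.Unary.AllPairs.Properties as AllPairs
open import Data.List.Relation.Unary.Any as Any using (Any; here; there; any?)
open import Data.List.Relation.Unary.Unique.Propositional using (Unique)
import Data.List.Relation.Unary.Unique.Propositional.Properties as Unique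
open import Data.Nat using (ℕ; zero; suc; _+_; _*_; _∸_; _^_; _≤_; _<_; z≤n; s≤s; _⊓_; _⊔_; ⌊_/2⌋; ⌈_/2⌉; >-nonZero)
open import Data.Nat.ListAction using (sum)
open import Data.Nat.ListAction.Properties using (sum-++; sum-↭)
open import Data.Nat.Properties
open import Data.Nat.Tactic.RingSolver using (solve-∀)
open import Data.Product using (Σ-syntax; ∃-syntax; _×_; _,_; proj₁; proj₂)
open import Data.Sum using (_⊎_; inj₁; inj₂; [_,_]′)
open import Data.Vec as Vec using (Vec; []; _∷_)
import Data.Vec.Properties as Vec
open import Data.Vec.Relation.Binary.Pointwise.Inductive as Pointwise using ([]; _∷_)
open import Function using (_∘_; flip; id)
open import Relation.Nullary using (Dec; yes; no; does; contradiction)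
open import Relation.Nullary.Decidable using (dec-true)
open import Relation.Binary.PropositionalEquality using (_≡_; _≢_; refl; sym; trans; cong; cong₂; subst; module ≡-Reasoning)

-- Coding an antichain along one chain decomposition of [t]ⁿ costs about the logarithm of the chain
-- length per chain, hence a logarithmic factor over `α`. A product of two chains of lengths p and q
-- costs only p + q bits. The price is an analytic question: the code length is of order M ∑ f,
-- while a level supplies only ∑ f(x)², so f must carry a constant share of its mass where it is
-- comparable to its maximum. Log-concavity ensures this, because after the first drop to M / 2 the
-- sequence decays geometrically. In odd dimension the level is ∑ f(x) f(x + j) over all x and all
-- shifts j < t, so the plateau of f must also be of length at least of order t. This follows from t
-- M ≤ tᵃ: all coordinates but one determine a point of given rank. A parameter `w`, equal to 1 or
-- to t, treats both parities at once. The constant is 512 = 2 · 4 · 64: 2 from the code length, 4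
-- from ∑ f ≤ 4 K M, and 64 from counting pairs on the plateau.

-- Finite sums of natural numbers

∑ : ℕ → (ℕ → ℕ) → ℕ
∑ zero    f = 0
∑ (suc n) f = f 0 + ∑ n (λ i → f (suc i))

∑-cong : ∀ n {f g} → (∀ i → i < n → f i ≡ g i) → ∑ n f ≡ ∑ n g
∑-cong zero    e = refl
∑-cong (suc n) e = cong₂ _+_ (e 0 (s≤s z≤n)) (∑-cong n (λ i i<n → e (suc i) (s≤s i<n)))

∑-mono : ∀ n {f g} → (∀ i → i < n → f i ≤ g i) → ∑ n f ≤ ∑ n g
∑-mono zero    e = z≤n
∑-mono (suc n) e = +-mono-≤ (e 0 (s≤s z≤n)) (∑-mono n (λ i i<n → e (suc i) (s≤s i<n)))

∑-zero : ∀ n → ∑ n (λ _ → 0) ≡ 0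
∑-zero zero    = refl
∑-zero (suc n) = ∑-zero n

∑-const : ∀ n c → ∑ n (λ _ → c) ≡ n * c
∑-const zero    c = refl
∑-const (suc n) c = cong (c +_) (∑-const n c)

∑-+ : ∀ n f g → ∑ n (λ i → f i + g i) ≡ ∑ n f + ∑ n g
∑-+ zero    f g = refl
∑-+ (suc n) f g = trans (cong (f 0 + g 0 +_) (∑-+ n (λ i → f (suc i)) (λ i → g (suc i))))
  (interchange (f 0) (g 0) (∑ n (λ i → f (suc i))) (∑ n (λ i → g (suc i))))
  where
  interchange : ∀ a b c d → a + b + (c + d) ≡ a + c + (b + d)
  interchange = solve-∀

∑-*ˡ : ∀ n c f → ∑ n (λ i → c * f i) ≡ c * ∑ n f
∑-*ˡ zero    c f = sym (*-zeroʳ c)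
∑-*ˡ (suc n) c f = trans (cong (c * f 0 +_) (∑-*ˡ n c (λ i → f (suc i))))
  (sym (*-distribˡ-+ c (f 0) (∑ n (λ i → f (suc i)))))

∑-*ʳ : ∀ n c f → ∑ n (λ i → f i * c) ≡ ∑ n f * c
∑-*ʳ n c f = trans (∑-cong n (λ i _ → *-comm (f i) c)) (trans (∑-*ˡ n c f) (*-comm c (∑ n f)))

∑-swap : ∀ m n (f : ℕ → ℕ → ℕ) → ∑ m (λ i → ∑ n (f i)) ≡ ∑ n (λ j → ∑ m (λ i → f i j))
∑-swap zero    n f = sym (∑-zero n)
∑-swap (suc m) n f = trans (cong (∑ n (f 0) +_) (∑-swap m n (λ i → f (suc i))))
  (sym (∑-+ n (f 0) (λ j → ∑ m (λ i → f (suc i) j))))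

∑-split : ∀ m n f → ∑ (m + n) f ≡ ∑ m f + ∑ n (λ i → f (m + i))
∑-split zero    n f = refl
∑-split (suc m) n f = trans (cong (f 0 +_) (∑-split m n (λ i → f (suc i))))
  (sym (+-assoc (f 0) (∑ m (λ i → f (suc i))) _))

∑-last : ∀ n f → ∑ (suc n) f ≡ ∑ n f + f n
∑-last zero    f = +-comm (f 0) 0
∑-last (suc n) f = trans (cong (f 0 +_) (∑-last n (λ i → f (suc i))))
  (sym (+-assoc (f 0) (∑ n (λ i → f (suc i))) _))

∑-reverse : ∀ n f → ∑ n f ≡ ∑ n (λ i → f (n ∸ suc i))
∑-reverse zero    f = refl
∑-reverse (suc n) f = trans (∑-last n f) (trans (+-comm (∑ n f) (f n)) (cong (f n +_) (∑-reverse n f)))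

∑-extend : ∀ {m n} f → m ≤ n → ∑ m f ≤ ∑ n f
∑-extend {m} {n} f m≤n = subst (λ k → ∑ m f ≤ ∑ k f) (m+[n∸m]≡n m≤n)
  (≤-trans (m≤m+n (∑ m f) _) (≤-reflexive (sym (∑-split m (n ∸ m) f))))

-- Log-concave sequences and sliding windows

-- Moving two arguments towards each other increases the product. The local inequality f(x - 1) f(x
-- + 1) ≤ f(x)² would be weaker in the presence of zeros: 1, 0, 0, 1 satisfies it but not this form.
LogConcave : (ℕ → ℕ) → Set
LogConcave f = ∀ {x y} d → x ≤ y → f x * f (y + d) ≤ f (x + d) * f y

-- Unlike the division-based argument, this needs no assumption on zeros: once x
-- has been moved up to y, both sides agree.
logConcave-fromStep : ∀ f → (∀ {x y} → x ≤ y → f x * f (suc y) ≤ f (suc x) * f y) → LogConcave f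
logConcave-fromStep f step {x} {y} zero x≤y
  rewrite +-identityʳ x | +-identityʳ y = ≤-refl
logConcave-fromStep f step {x} {y} (suc d) x≤y with m≤n⇒m<n∨m≡n x≤y
... | inj₂ refl = ≤-reflexive (*-comm (f x) (f (x + suc d)))
... | inj₁ x<y  rewrite +-suc x d | +-suc y d = ≤-trans (step (≤-trans x≤y (m≤m+n y d)))
                  (logConcave-fromStep f step d x<y)

window : ℕ → (ℕ → ℕ) → ℕ → ℕ
window t f x = ∑ t (λ i → f (x + i))

window-suc : ∀ t f x → window t f (suc x) + f x ≡ window t f x + f (x + t)
window-suc t f x = begin
  window t f (suc x) + f x             ≡⟨ +-comm (window t f (suc x)) (f x) ⟩
  f x + ∑ t (λ i → f (suc x + i))      ≡⟨ cong₂ _+_ (cong f (sym (+-identityʳ x))) (∑-cong t (λ i _ → cong f (sym (+-suc x i)))) ⟩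
  ∑ (suc t) (λ i → f (x + i))          ≡⟨ ∑-last t (λ i → f (x + i)) ⟩
  window t f x + f (x + t)             ∎
  where open ≡-Reasoning

-- Write g for the window. Substituting g(x + 1) = g(x) + f(x + t) - f(x) in the one-step inequality
-- and cancelling g(x) g(y) leaves the sum of `upper` and `lower`, each of which holds term by term.
-- Adding `g x * f y + f x * g y` to both sides avoids subtraction.
window-logConcave : ∀ t f → LogConcave f → LogConcave (window t f)
window-logConcave t f lc = logConcave-fromStep g step
  where
  g = window t f
  upper : ∀ {x y} → x ≤ y → g x * f (y + t) ≤ f (x + t) * g y
  upper {x} {y} x≤y = begin
    g x * f (y + t)                        ≡⟨ sym (∑-*ʳ t (f (y + t)) (λ i → f (x + i))) ⟩
    ∑ t (λ i → f (x + i) * f (y + t))      ≤⟨ ∑-mono t term ⟩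
    ∑ t (λ i → f (x + t) * f (y + i))      ≡⟨ ∑-*ˡ t (f (x + t)) (λ i → f (y + i)) ⟩
    f (x + t) * g y                        ∎
    where
    open ≤-Reasoning
    up : ∀ z i → i < t → z + i + (t ∸ i) ≡ z + t
    up z i i<t = trans (+-assoc z i (t ∸ i)) (cong (z +_) (m+[n∸m]≡n (<⇒≤ i<t)))
    term : ∀ i → i < t → f (x + i) * f (y + t) ≤ f (x + t) * f (y + i)
    term i i<t = begin
      f (x + i) * f (y + t)            ≡⟨ cong (λ z → f (x + i) * f z) (sym (up y i i<t)) ⟩
      f (x + i) * f (y + i + (t ∸ i))  ≤⟨ lc (t ∸ i) (+-monoˡ-≤ i x≤y) ⟩
      f (x + i + (t ∸ i)) * f (y + i)  ≡⟨ cong (λ z → f z * f (y + i)) (up x i i<t) ⟩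
      f (x + t) * f (y + i)            ∎
  lower : ∀ {x y} → x ≤ y → f x * g y ≤ g x * f y
  lower {x} {y} x≤y = begin
    f x * g y                      ≡⟨ sym (∑-*ˡ t (f x) (λ i → f (y + i))) ⟩
    ∑ t (λ i → f x * f (y + i))    ≤⟨ ∑-mono t (λ i _ → lc i x≤y) ⟩
    ∑ t (λ i → f (x + i) * f y)    ≡⟨ ∑-*ʳ t (f y) (λ i → f (x + i)) ⟩
    g x * f y                      ∎
    where open ≤-Reasoning
  step : ∀ {x y} → x ≤ y → g x * g (suc y) ≤ g (suc x) * g y
  step {x} {y} x≤y = +-cancelʳ-≤ (g x * f y + f x * g y) _ _ (begin
    g x * g (suc y) + (g x * f y + f x * g y)      ≡⟨ e₁ (g x) (g (suc y)) (f y) (f x * g y) ⟩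
    g x * (g (suc y) + f y) + f x * g y            ≡⟨ cong (λ z → g x * z + f x * g y) (window-suc t f y) ⟩
    g x * (g y + f (y + t)) + f x * g y            ≡⟨ e₂ (g x) (g y) (f (y + t)) (f x * g y) ⟩
    g x * g y + (g x * f (y + t) + f x * g y)      ≤⟨ +-monoʳ-≤ (g x * g y) (+-mono-≤ (upper x≤y) (lower x≤y)) ⟩
    g x * g y + (f (x + t) * g y + g x * f y)      ≡⟨ e₃ (g x) (g y) (f (x + t)) (g x * f y) ⟩
    (g x + f (x + t)) * g y + g x * f y            ≡⟨ cong (λ z → z * g y + g x * f y) (sym (window-suc t f x)) ⟩
    (g (suc x) + f x) * g y + g x * f y            ≡⟨ e₄ (g (suc x)) (f x) (g y) (g x * f y) ⟩
    g (suc x) * g y + (g x * f y + f x * g y)      ∎)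
    where
    open ≤-Reasoning
    e₁ : ∀ a b c d → a * b + (a * c + d) ≡ a * (b + c) + d
    e₁ = solve-∀
    e₂ : ∀ a b c d → a * (b + c) + d ≡ a * b + (a * c + d)
    e₂ = solve-∀
    e₃ : ∀ a b c d → a * b + (c * b + d) ≡ (a + c) * b + d
    e₃ = solve-∀
    e₄ : ∀ a b c d → (a + b) * c + d ≡ a * c + (d + b * c)
    e₄ = solve-∀

-- Level sizes of the grid, by recursion on the dimension

δ : ℕ → ℕ → ℕ
δ zero    zero    = 1
δ zero    (suc k) = 0
δ (suc s) zero    = 0
δ (suc s) (suc k) = δ s k

δ-refl : ∀ s → δ s s ≡ 1
δ-refl zero    = refl
δ-refl (suc s) = δ-refl s

δ-≢ : ∀ {s k} → s ≢ k → δ s k ≡ 0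
δ-≢ {zero}  {zero}  s≢k = contradiction refl s≢k
δ-≢ {zero}  {suc k} s≢k = refl
δ-≢ {suc s} {zero}  s≢k = refl
δ-≢ {suc s} {suc k} s≢k = δ-≢ (λ e → s≢k (cong suc e))

∑-δ : ∀ n s f → ∑ n (λ x → δ s x * f x) ≤ f s
∑-δ zero    s       f = z≤n
∑-δ (suc n) zero    f = ≤-reflexive (trans (cong (f 0 + 0 +_) (∑-zero n)) (trans (+-identityʳ _) (+-identityʳ _)))
∑-δ (suc n) (suc s) f = ∑-δ n s (λ x → f (suc x))

∑-δ≡1 : ∀ n s → s < n → ∑ n (δ s) ≡ 1
∑-δ≡1 (suc n) zero    _         = cong suc (∑-zero n)
∑-δ≡1 (suc n) (suc s) (s≤s s<n) = ∑-δ≡1 n s s<n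

∑-δ-shift≤1 : ∀ n s k → ∑ n (λ x → δ (s + x) k) ≤ 1
∑-δ-shift≤1 zero    s k = z≤n
∑-δ-shift≤1 (suc n) s k with s + 0 ≟ k
... | yes e = ≤-reflexive (cong₂ _+_ (trans (cong (λ z → δ z k) e) (δ-refl k))
        (trans (∑-cong n (λ i _ → δ-≢ (λ e′ → m≢1+m+n s (trans (sym (+-identityʳ s)) (trans e (trans (sym e′) (+-suc s i)))))) ) (∑-zero n)))
... | no ¬e rewrite δ-≢ ¬e = ≤-trans (≤-reflexive (∑-cong n (λ i _ → cong (λ z → δ z k) (+-suc s i)))) (∑-δ-shift≤1 n (suc s) k)

-- The left side is nonzero only if x = k = y + d. Then x ≤ y forces x = y, and the two sides agree.
δ-logConcave : ∀ k → LogConcave (λ s → δ s k)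
δ-logConcave k {x} {y} d x≤y with x ≟ k | (y + d) ≟ k
... | no ¬p    | _      rewrite δ-≢ ¬p = z≤n
... | yes refl | no ¬q  rewrite δ-≢ ¬q = ≤-trans (≤-reflexive (*-zeroʳ (δ x x))) z≤n
... | yes refl | yes q  with refl ← ≤-antisym x≤y (≤-trans (m≤m+n y d) (≤-reflexive q)) = ≤-reflexive (*-comm (δ y y) (δ (y + d) y))

-- The number of p ∈ [t]ᵃ with s + rank p = k.
W : ℕ → ℕ → ℕ → ℕ → ℕ
W t k zero    s = δ s k
W t k (suc a) s = window t (W t k a) s

W-logConcave : ∀ t k a → LogConcave (W t k a)
W-logConcave t k zero    = δ-logConcave k
W-logConcave t k (suc a) = window-logConcave t (W t k a) (W-logConcave t k a)

-- Reflecting every coordinate, i to t - i, carries one set of points to the other. Since both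
-- targets and both shifts are free, this also trades a shift for a change of target, as in
-- `f-level`.
W-sym : ∀ t k k′ a s s′ → k + k′ ≡ s + s′ + a * t → W (suc t) k a s ≡ W (suc t) k′ a s′
W-sym t k k′ zero s s′ e with s ≟ k | s′ ≟ k′
... | yes refl | yes refl = trans (δ-refl s) (sym (δ-refl s′))
... | no p     | no q     = trans (δ-≢ p) (sym (δ-≢ q))
... | yes refl | no q     = contradiction (sym (+-cancelˡ-≡ s _ _ (trans e (+-identityʳ _)))) q
... | no p     | yes refl = contradiction (sym (+-cancelʳ-≡ s′ _ _ (trans e (+-identityʳ _)))) p
W-sym t k k′ (suc a) s s′ e = trans
  (∑-cong (suc t) (λ { i (s≤s i≤t) → W-sym t k k′ a (s + i) (s′ + (t ∸ i)) (trans e (begin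
    s + s′ + (t + a * t)               ≡⟨ cong (λ z → s + s′ + (z + a * t)) (sym (m+[n∸m]≡n i≤t)) ⟩
    s + s′ + (i + (t ∸ i) + a * t)     ≡⟨ ring s s′ i (t ∸ i) (a * t) ⟩
    s + i + (s′ + (t ∸ i)) + a * t     ∎)) }))
  (sym (∑-reverse (suc t) (λ i → W (suc t) k′ a (s′ + i))))
  where
  open ≡-Reasoning
  ring : ∀ a b c d e → a + b + (c + d + e) ≡ a + c + (b + d) + e
  ring = solve-∀

W-zero : ∀ t k a s → k < s → W t k a s ≡ 0
W-zero t k zero    s k<s = δ-≢ (λ e → <⇒≢ k<s (sym e))
W-zero t k (suc a) s k<s = trans (∑-cong t (λ i _ → W-zero t k a (s + i) (≤-trans k<s (m≤m+n s i)))) (∑-zero t)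

∑-levels : ∀ t a n s → s + a * t < n → ∑ n (λ k → W (suc t) k a s) ≡ suc t ^ a
∑-levels t zero    n s s<n = ∑-δ≡1 n s (subst (_< n) (+-identityʳ s) s<n)
∑-levels t (suc a) n s s<n = trans (∑-swap n (suc t) (λ k i → W (suc t) k a (s + i)))
  (trans (∑-cong (suc t) (λ { i (s≤s i≤t) → ∑-levels t a n (s + i)
      (≤-trans (s≤s (≤-trans (≤-reflexive (+-assoc s i (a * t))) (+-monoʳ-≤ s (+-monoˡ-≤ (a * t) i≤t)))) s<n) }))
    (∑-const (suc t) (suc t ^ a)))

-- Each point of [t]ᵃ admits at most one shift x. For n = t the left side unfolds to
-- `W t k (suc a) s`, so a level of [t]ᵃ⁺¹ has at most tᵃ points.
∑-W≤ : ∀ t k a n s → ∑ n (λ x → W t k a (s + x)) ≤ t ^ a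
∑-W≤ t k zero    n s = ∑-δ-shift≤1 n s k
∑-W≤ t k (suc a) n s = begin
  ∑ n (λ x → ∑ t (λ i → W t k a (s + x + i)))   ≡⟨ ∑-swap n t (λ x i → W t k a (s + x + i)) ⟩
  ∑ t (λ i → ∑ n (λ x → W t k a (s + x + i)))   ≤⟨ ∑-mono t (λ i _ → ≤-trans (≤-reflexive (∑-cong n (λ x _ → cong (W t k a) (ring s x i)))) (∑-W≤ t k a n (s + i))) ⟩
  ∑ t (λ i → t ^ a)                             ≡⟨ ∑-const t (t ^ a) ⟩
  t * t ^ a                                     ∎
  where
  open ≤-Reasoning
  ring : ∀ a b c → a + b + c ≡ a + c + b
  ring = solve-∀

-- Concatenate p and q with r + rank p = x and s + x + rank q = k. It is an inequality because `n`
-- may cut off some values of x.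
W-convolution : ∀ t k a b n s r → ∑ n (λ x → W t x a r * W t k b (s + x)) ≤ W t k (a + b) (s + r)
W-convolution t k zero    b n s r = ∑-δ n r (λ x → W t k b (s + x))
W-convolution t k (suc a) b n s r = begin
  ∑ n (λ x → ∑ t (λ i → W t x a (r + i)) * W t k b (s + x))
    ≡⟨ ∑-cong n (λ x _ → sym (∑-*ʳ t (W t k b (s + x)) (λ i → W t x a (r + i)))) ⟩
  ∑ n (λ x → ∑ t (λ i → W t x a (r + i) * W t k b (s + x)))
    ≡⟨ ∑-swap n t (λ x i → W t x a (r + i) * W t k b (s + x)) ⟩
  ∑ t (λ i → ∑ n (λ x → W t x a (r + i) * W t k b (s + x)))
    ≤⟨ ∑-mono t (λ i _ → W-convolution t k a b n s (r + i)) ⟩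
  ∑ t (λ i → W t k (a + b) (s + (r + i)))
    ≡⟨ ∑-cong t (λ i _ → cong (W t k (a + b)) (sym (+-assoc s r i))) ⟩
  ∑ t (λ i → W t k (a + b) (s + r + i)) ∎
  where open ≤-Reasoning

-- Autocorrelation of a symmetric log-concave sequence

m*m≤n*n⇒m≤n : ∀ {m n} → m * m ≤ n * n → m ≤ n
m*m≤n*n⇒m≤n {m} {n} mm≤nn with m ≤? n
... | yes m≤n = m≤n
... | no  m≰n = contradiction mm≤nn (<⇒≱ (*-mono-< (≰⇒> m≰n) (≰⇒> m≰n)))

⌈n/2⌉≤1+⌊n/2⌋ : ∀ n → ⌈ n /2⌉ ≤ suc ⌊ n /2⌋
⌈n/2⌉≤1+⌊n/2⌋ zero          = z≤n
⌈n/2⌉≤1+⌊n/2⌋ (suc zero)    = ≤-refl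
⌈n/2⌉≤1+⌊n/2⌋ (suc (suc n)) = s≤s (⌈n/2⌉≤1+⌊n/2⌋ n)

-- With c the maximum of h, the same k serves twice: h is at least c / 2 before k, and `2 * h k ≤ c`
-- starts the geometric decay after k.
halvingIndex : ∀ (h : ℕ → ℕ) c n → h n ≡ 0 → ∃[ k ] (2 * h k ≤ c × (∀ d → d < k → c ≤ 2 * h d))
halvingIndex h c zero    hn≡0 = 0 , ≤-trans (≤-reflexive (cong (2 *_) hn≡0)) z≤n , (λ d ())
halvingIndex h c (suc n) hn≡0 with 2 * h 0 ≤? c
... | yes p = 0 , p , (λ d ())
... | no ¬p with halvingIndex (λ d → h (suc d)) c n hn≡0
...   | k , below , above = suc k , below , λ { zero _ → <⇒≤ (≰⇒> ¬p) ; (suc d) (s≤s d<k) → above d d<k }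

-- h (k + d) ≤ h d / 2 by log-concavity, so each block of k terms has at most half the sum of the previous one.
∑-halving : ∀ (h : ℕ → ℕ) k n → 0 < h 0 → (∀ d e → h 0 * h (d + e) ≤ h d * h e) → (∀ d → h d ≤ h 0) →
            2 * h k ≤ h 0 → ∑ n h ≤ 2 * (k * h 0)
∑-halving h k n h0>0 sub max half = +-cancelʳ-≤ (∑ n h) _ _ (begin
  ∑ n h + ∑ n h                                  ≡⟨ cong (∑ n h +_) (sym (+-identityʳ (∑ n h))) ⟩
  -- Extending the sum to k + n terms leaves a tail of exactly n terms. Doubled, it is at most
  -- `∑ n h`, which cancels against the copy added at the start.
  2 * ∑ n h                                      ≤⟨ *-monoʳ-≤ 2 (∑-extend h (m≤n+m n k)) ⟩
  2 * ∑ (k + n) h                                ≡⟨ cong (2 *_) (∑-split k n h) ⟩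
  2 * (∑ k h + ∑ n (λ d → h (k + d)))            ≡⟨ *-distribˡ-+ 2 (∑ k h) _ ⟩
  2 * ∑ k h + 2 * ∑ n (λ d → h (k + d))          ≡⟨ cong (2 * ∑ k h +_) (sym (∑-*ˡ n 2 (λ d → h (k + d)))) ⟩
  2 * ∑ k h + ∑ n (λ d → 2 * h (k + d))          ≤⟨ +-mono-≤ (*-monoʳ-≤ 2 (≤-trans (∑-mono k (λ d _ → max d)) (≤-reflexive (∑-const k (h 0))))) (∑-mono n (λ d _ → halved d)) ⟩
  2 * (k * h 0) + ∑ n h                          ∎)
  where
  open ≤-Reasoning
  comm₂ : ∀ a b → a * (2 * b) ≡ 2 * (a * b)
  comm₂ = solve-∀
  halved : ∀ d → 2 * h (k + d) ≤ h d
  halved d = *-cancelˡ-≤ (h 0) {{>-nonZero h0>0}} (begin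
    h 0 * (2 * h (k + d))    ≡⟨ comm₂ (h 0) (h (k + d)) ⟩
    2 * (h 0 * h (k + d))    ≤⟨ *-monoʳ-≤ 2 (sub k d) ⟩
    2 * (h k * h d)          ≡⟨ sym (*-assoc 2 (h k) (h d)) ⟩
    2 * h k * h d            ≤⟨ *-monoˡ-≤ (h d) half ⟩
    h 0 * h d                ∎)

-- The pairs (d , j) with d < ⌈k/2⌉ and j < w ⊓ (1 + ⌊k/2⌋) already suffice.
∑-plateau : ∀ (h : ℕ → ℕ) k w c → w ≤ 4 * k → (∀ d → d < k → c ≤ 2 * h d) →
            k * (c * c) * w ≤ 64 * ∑ w (λ j → ∑ ⌈ k /2⌉ (λ d → h d * h (d + j)))
∑-plateau h k w c w≤4k above = begin
  -- The factor 64 is 2 · 8 · 4, from k ≤ 2 k₁, w ≤ 8 J and c² ≤ 4 h(d) h(d + j).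
  k * (c * c) * w                     ≤⟨ *-mono-≤ (*-monoˡ-≤ (c * c) k≤2k₁) w≤8J ⟩
  2 * k₁ * (c * c) * (8 * J)          ≡⟨ ring k₁ c J ⟩
  16 * (J * (k₁ * (c * c)))           ≡⟨ cong (16 *_) (sym (trans (∑-cong J (λ _ _ → ∑-const k₁ (c * c))) (∑-const J _))) ⟩
  16 * ∑ J (λ j → ∑ k₁ (λ d → c * c)) ≤⟨ *-monoʳ-≤ 16 (∑-mono J (λ j j<J → ∑-mono k₁ (λ d d<k₁ → term d j d<k₁ j<J))) ⟩
  16 * ∑ J (λ j → ∑ k₁ (λ d → 4 * (h d * h (d + j))))
    ≡⟨ cong (16 *_) (trans (∑-cong J (λ j _ → ∑-*ˡ k₁ 4 (λ d → h d * h (d + j)))) (∑-*ˡ J 4 G)) ⟩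
  16 * (4 * ∑ J G)                    ≡⟨ sym (*-assoc 16 4 (∑ J G)) ⟩
  64 * ∑ J G                          ≤⟨ *-monoʳ-≤ 64 (∑-extend G (m⊓n≤m w (suc k₂))) ⟩
  64 * ∑ w G                          ∎
  where
  open ≤-Reasoning
  k₁ = ⌈ k /2⌉
  k₂ = ⌊ k /2⌋
  -- From d < k₁ and j ≤ k₂ it follows that d + j < k. The `suc` keeps `J` positive for positive w
  -- even when k₂ = 0, as w ≤ 8 J requires.
  J  = w ⊓ suc k₂
  G : ℕ → ℕ
  G j = ∑ k₁ (λ d → h d * h (d + j))
  ring : ∀ k c j → 2 * k * (c * c) * (8 * j) ≡ 16 * (j * (k * (c * c)))
  ring = solve-∀
  ring′ : ∀ a b → 2 * a * (2 * b) ≡ 4 * (a * b)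
  ring′ = solve-∀
  k≤2k₁ : k ≤ 2 * k₁
  k≤2k₁ = begin
    k             ≡⟨ sym (⌊n/2⌋+⌈n/2⌉≡n k) ⟩
    k₂ + k₁       ≤⟨ +-monoˡ-≤ k₁ (⌊n/2⌋≤⌈n/2⌉ k) ⟩
    k₁ + k₁       ≡⟨ cong (k₁ +_) (sym (+-identityʳ k₁)) ⟩
    2 * k₁        ∎
  w≤8J : w ≤ 8 * J
  w≤8J with ⊓-sel w (suc k₂)
  ... | inj₁ e rewrite e = m≤n*m w 8
  ... | inj₂ e rewrite e = begin
    w                    ≤⟨ w≤4k ⟩
    4 * k                ≤⟨ *-monoʳ-≤ 4 k≤2k₁ ⟩
    4 * (2 * k₁)         ≤⟨ *-monoʳ-≤ 4 (*-monoʳ-≤ 2 (⌈n/2⌉≤1+⌊n/2⌋ k)) ⟩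
    4 * (2 * suc k₂)     ≡⟨ sym (*-assoc 4 2 (suc k₂)) ⟩
    8 * suc k₂           ∎
  term : ∀ d j → d < k₁ → j < J → c * c ≤ 4 * (h d * h (d + j))
  term d j d<k₁ j<J = begin
    c * c                      ≤⟨ *-mono-≤ (above d (≤-trans (s≤s (m≤m+n d j)) d+j<k)) (above (d + j) d+j<k) ⟩
    2 * h d * (2 * h (d + j))  ≡⟨ ring′ (h d) (h (d + j)) ⟩
    4 * (h d * h (d + j))      ∎
    where
    d+j<k : d + j < k
    d+j<k = begin
      suc (d + j)   ≤⟨ +-mono-≤ d<k₁ (≤-pred (≤-trans j<J (m⊓n≤n w (suc k₂)))) ⟩
      k₁ + k₂       ≡⟨ +-comm k₁ k₂ ⟩
      k₂ + k₁       ≡⟨ ⌊n/2⌋+⌈n/2⌉≡n k ⟩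
      k             ∎

-- On an interval [m , m + k) carrying a constant fraction of its mass, f is at
-- least half of its maximum f m.
autocorrelation : ∀ f B m w → LogConcave f → (∀ {x y} → x + y ≡ B → f x ≡ f y) → (∀ x → B < x → f x ≡ 0) →
                  m + m ≤ B → B ≤ suc (m + m) → 0 < f m → w * f m ≤ ∑ (suc B) f →
                  ∃[ n ] (∑ (suc B) f * f m * w ≤ 256 * ∑ w (λ j → ∑ n (λ x → f x * f (j + x))))
autocorrelation f B m w lc symm van lo hi pos wM≤T = m + ⌈ k /2⌉ , bound
  where
  open ≤-Reasoning
  T M : ℕ
  T = ∑ (suc B) f
  M = f m
  h : ℕ → ℕ
  h d = f (m + d)

  h0≡M : h 0 ≡ M
  h0≡M = cong f (+-identityʳ m)

  m≤B : m ≤ B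
  m≤B = ≤-trans (m≤m+n m m) lo

  -- Reflection exchanges v + d with u and u + d with v, so log-concavity reads f(u)² ≤ f(v)².
  unimodal : ∀ {u v} d → u + v + d ≡ B → u ≤ v → f u ≤ f v
  unimodal {u} {v} d e u≤v = m*m≤n*n⇒m≤n (begin
    f u * f u           ≡⟨ cong (f u *_) (symm (trans (sym (+-assoc u v d)) e)) ⟩
    f u * f (v + d)     ≤⟨ lc d u≤v ⟩
    f (u + d) * f v     ≡⟨ cong (_* f v) (symm (trans (trans (+-assoc u d v) (trans (cong (u +_) (+-comm d v)) (sym (+-assoc u v d)))) e)) ⟩
    f v * f v           ∎)

  h≤M : ∀ d → h d ≤ M
  h≤M zero = ≤-reflexive h0≡M
  h≤M (suc d) with m + suc d ≤? B
  ... | no  p = ≤-trans (≤-reflexive (van _ (≰⇒> p))) z≤n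
  -- The reflected index `u` satisfies u ≤ m because B ≤ 2 m + 1, so `unimodal` compares it with m.
  ... | yes p = ≤-trans (≤-reflexive (symm (m+[n∸m]≡n p)))
      (unimodal (suc d) (trans (+-assoc u m (suc d)) (m∸n+n≡m p))
        (+-cancelʳ-≤ (m + suc d) u m (begin
          u + (m + suc d)    ≡⟨ m∸n+n≡m p ⟩
          B                  ≤⟨ hi ⟩
          suc (m + m)        ≡⟨ sym (+-suc m m) ⟩
          m + suc m          ≤⟨ +-monoʳ-≤ m (≤-trans (≤-reflexive (+-comm 1 m)) (+-monoʳ-≤ m (s≤s z≤n))) ⟩
          m + (m + suc d)    ∎)))
    where u = B ∸ (m + suc d)

  h-van : h (suc B) ≡ 0
  h-van = van _ (m≤n+m (suc B) m)

  T≤2∑h : T ≤ 2 * ∑ (suc B) h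
  T≤2∑h = begin
    ∑ (suc B) f                                    ≡⟨ cong (λ z → ∑ z f) (sym (m+[n∸m]≡n (m≤n⇒m≤1+n m≤B))) ⟩
    ∑ (m + (suc B ∸ m)) f                          ≡⟨ ∑-split m (suc B ∸ m) f ⟩
    ∑ m f + ∑ (suc B ∸ m) h                        ≡⟨ cong (_+ ∑ (suc B ∸ m) h) (∑-reverse m f) ⟩
    ∑ m (λ i → f (m ∸ suc i)) + ∑ (suc B ∸ m) h    ≤⟨ +-mono-≤ (∑-mono m left) (∑-extend h (m∸n≤m (suc B) m)) ⟩
    ∑ m h + ∑ (suc B) h                            ≤⟨ +-monoˡ-≤ _ (∑-extend h (m≤n⇒m≤1+n m≤B)) ⟩
    ∑ (suc B) h + ∑ (suc B) h                      ≡⟨ cong (∑ (suc B) h +_) (sym (+-identityʳ _)) ⟩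
    2 * ∑ (suc B) h                                ∎
    where
    ring : ∀ u i c → u + (suc (u + i) + i) + suc c ≡ suc (u + i) + suc (u + i) + c
    ring = solve-∀
    -- The indices m - 1 - i and m + i sum to 2 m - 1, so the gap passed to `unimodal` is B - 2 m +
    -- 1.
    left : ∀ i → i < m → f (m ∸ suc i) ≤ h i
    left i i<m = unimodal (suc (B ∸ (m + m))) (begin-equality
        u + (m + i) + suc c                             ≡⟨ cong (λ z → u + (z + i) + suc c) (sym e) ⟩
        u + (suc (u + i) + i) + suc c                   ≡⟨ ring u i c ⟩
        suc (u + i) + suc (u + i) + c                   ≡⟨ cong (λ z → z + z + c) e ⟩
        m + m + c                                       ≡⟨ m+[n∸m]≡n lo ⟩
        B                                               ∎)
      (≤-trans (m∸n≤m m (suc i)) (m≤m+n m i))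
      where
      u = m ∸ suc i
      c = B ∸ (m + m)
      e : suc (u + i) ≡ m
      e = trans (sym (+-suc u i)) (m∸n+n≡m i<m)

  halving : ∃[ k ] (2 * h k ≤ M × (∀ d → d < k → M ≤ 2 * h d))
  halving = halvingIndex h M (suc B) h-van
  k : ℕ
  k = proj₁ halving
  below : 2 * h k ≤ M
  below = proj₁ (proj₂ halving)
  above : ∀ d → d < k → M ≤ 2 * h d
  above = proj₂ (proj₂ halving)

  ∑h≤2kM : ∑ (suc B) h ≤ 2 * (k * M)
  ∑h≤2kM = subst (λ z → ∑ (suc B) h ≤ 2 * (k * z)) h0≡M (∑-halving h k (suc B) (subst (0 <_) (sym h0≡M) pos)
    (λ d e → begin
      h 0 * h (d + e)            ≡⟨ cong₂ (λ x y → x * f y) h0≡M (trans (cong (m +_) (+-comm d e)) (sym (+-assoc m e d))) ⟩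
      f m * f (m + e + d)        ≤⟨ lc d (m≤m+n m e) ⟩
      h d * h e                  ∎)
    (λ d → ≤-trans (h≤M d) (≤-reflexive (sym h0≡M)))
    (≤-trans below (≤-reflexive (sym h0≡M))))

  T≤4kM : T ≤ 4 * k * M
  T≤4kM = begin
    T                      ≤⟨ T≤2∑h ⟩
    2 * ∑ (suc B) h        ≤⟨ *-monoʳ-≤ 2 ∑h≤2kM ⟩
    2 * (2 * (k * M))      ≡⟨ ring k M ⟩
    4 * k * M              ∎
    where
    ring : ∀ k M → 2 * (2 * (k * M)) ≡ 4 * k * M
    ring = solve-∀

  -- The hypothesis w M ≤ T enters here: it makes the plateau long enough for a constant fraction of
  -- the shifts j < w.
  w≤4k : w ≤ 4 * k
  w≤4k = *-cancelʳ-≤ w (4 * k) M {{>-nonZero pos}} (≤-trans wM≤T T≤4kM)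

  bound : T * M * w ≤ 256 * ∑ w (λ j → ∑ (m + ⌈ k /2⌉) (λ x → f x * f (j + x)))
  bound = begin
    T * M * w                           ≤⟨ *-monoˡ-≤ w (*-monoˡ-≤ M T≤4kM) ⟩
    4 * k * M * M * w                   ≡⟨ ring k M w ⟩
    4 * (k * (M * M) * w)               ≤⟨ *-monoʳ-≤ 4 (∑-plateau h k w M w≤4k above) ⟩
    4 * (64 * ∑ w (λ j → ∑ ⌈ k /2⌉ (λ d → h d * h (d + j))))
      ≡⟨ sym (*-assoc 4 64 (∑ w (λ j → ∑ ⌈ k /2⌉ (λ d → h d * h (d + j))))) ⟩
    256 * ∑ w (λ j → ∑ ⌈ k /2⌉ (λ d → h d * h (d + j)))
      ≤⟨ *-monoʳ-≤ 256 (∑-mono w (λ j _ → row j)) ⟩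
    256 * ∑ w (λ j → ∑ (m + ⌈ k /2⌉) (λ x → f x * f (j + x))) ∎
    where
    ring : ∀ k M w → 4 * k * M * M * w ≡ 4 * (k * (M * M) * w)
    ring = solve-∀
    shift : ∀ j d → m + (d + j) ≡ j + (m + d)
    shift j d = trans (sym (+-assoc m d j)) (+-comm (m + d) j)
    row : ∀ j → ∑ ⌈ k /2⌉ (λ d → h d * h (d + j)) ≤ ∑ (m + ⌈ k /2⌉) (λ x → f x * f (j + x))
    row j = begin
      ∑ ⌈ k /2⌉ (λ d → h d * h (d + j))           ≡⟨ ∑-cong ⌈ k /2⌉ (λ d _ → cong (λ z → h d * f z) (shift j d)) ⟩
      ∑ ⌈ k /2⌉ (λ d → h d * f (j + (m + d)))     ≤⟨ m≤n+m _ (∑ m (λ x → f x * f (j + x))) ⟩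
      ∑ m (λ x → f x * f (j + x)) + ∑ ⌈ k /2⌉ (λ d → h d * f (j + (m + d)))
        ≡⟨ sym (∑-split m ⌈ k /2⌉ (λ x → f x * f (j + x))) ⟩
      ∑ (m + ⌈ k /2⌉) (λ x → f x * f (j + x))     ∎

-- a * t is the rank of the top of [1 + t]ᵃ, so ⌊ a * t /2⌋ is its middle level.
middleLevel-autocorrelation : ∀ t a w → 1 ≤ a → w ≤ suc t →
  suc t ^ a * W (suc t) (a * t) a ⌊ a * t /2⌋ * w ≤ 256 * ∑ w (W (suc t) (a * t) (a + a))
-- `autocorrelation` cancels a factor `f m`, so it needs `0 < f m`. If `f m` is 0 the left side
-- vanishes, and no proof that the middle level is inhabited is required.
middleLevel-autocorrelation t (suc a) w _ w≤ = [ positive , empty ]′ (m≤n⇒m<n∨m≡n z≤n)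
  where
  open ≤-Reasoning
  B m : ℕ
  B = suc a * t
  m = ⌊ B /2⌋
  f : ℕ → ℕ
  f = W (suc t) B (suc a)
  -- As defined, `f x` counts the points of rank B - x. Reflection turns this into rank x, the form
  -- that the first factor of `W-convolution` needs.
  f-level : ∀ x → W (suc t) x (suc a) 0 ≡ f x
  f-level x = W-sym t x B (suc a) 0 x refl
  total : ∑ (suc B) f ≡ suc t ^ suc a
  total = trans (∑-cong (suc B) (λ x _ → sym (f-level x))) (∑-levels t (suc a) (suc B) 0 ≤-refl)
  lo : m + m ≤ B
  lo = ≤-trans (+-monoʳ-≤ m (⌊n/2⌋≤⌈n/2⌉ B)) (≤-reflexive (⌊n/2⌋+⌈n/2⌉≡n B))
  hi : B ≤ suc (m + m)
  hi = ≤-trans (≤-reflexive (sym (⌊n/2⌋+⌈n/2⌉≡n B))) (≤-trans (+-monoʳ-≤ m (⌈n/2⌉≤1+⌊n/2⌋ B)) (≤-reflexive (+-suc m m)))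
  -- Here at least one coordinate is needed: `f m` is a window over [1 + t]ᵃ, hence at most (1 +
  -- t)ᵃ.
  wM≤T : w * f m ≤ ∑ (suc B) f
  wM≤T = begin
    w * f m              ≤⟨ *-mono-≤ w≤ (∑-W≤ (suc t) B a (suc t) m) ⟩
    suc t * suc t ^ a    ≡⟨ sym total ⟩
    ∑ (suc B) f          ∎
  positive : 0 < f m → suc t ^ suc a * f m * w ≤ 256 * ∑ w (W (suc t) B (suc a + suc a))
  positive pos = begin
    suc t ^ suc a * f m * w                                   ≡⟨ cong (λ z → z * f m * w) (sym total) ⟩
    ∑ (suc B) f * f m * w                                     ≤⟨ proj₂ correlation ⟩
    256 * ∑ w (λ j → ∑ n (λ x → f x * f (j + x)))             ≤⟨ *-monoʳ-≤ 256 (∑-mono w (λ j _ → row j)) ⟩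
    256 * ∑ w (W (suc t) B (suc a + suc a))                   ∎
    where
    correlation = autocorrelation f B m w (W-logConcave (suc t) B (suc a))
      (λ {x} {y} e → W-sym t B B (suc a) x y (cong (_+ B) (sym e)))
      (λ x → W-zero (suc t) B (suc a) x) lo hi pos wM≤T
    n = proj₁ correlation
    row : ∀ j → ∑ n (λ x → f x * f (j + x)) ≤ W (suc t) B (suc a + suc a) j
    row j = begin
      ∑ n (λ x → f x * f (j + x))                          ≡⟨ ∑-cong n (λ x _ → cong (_* f (j + x)) (sym (f-level x))) ⟩
      ∑ n (λ x → W (suc t) x (suc a) 0 * f (j + x))        ≤⟨ W-convolution (suc t) B (suc a) (suc a) n j 0 ⟩
      W (suc t) B (suc a + suc a) (j + 0)                  ≡⟨ cong (W (suc t) B (suc a + suc a)) (+-identityʳ j) ⟩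
      W (suc t) B (suc a + suc a) j                        ∎
  empty : 0 ≡ f m → suc t ^ suc a * f m * w ≤ 256 * ∑ w (W (suc t) B (suc a + suc a))
  empty e = begin
    suc t ^ suc a * f m * w    ≡⟨ cong (λ z → suc t ^ suc a * z * w) (sym e) ⟩
    suc t ^ suc a * 0 * w      ≡⟨ cong (_* w) (*-zeroʳ (suc t ^ suc a)) ⟩
    0                          ≤⟨ z≤n ⟩
    256 * ∑ w (W (suc t) B (suc a + suc a)) ∎

-- The rank function and the order

rank : ∀ {t n} → Point t n → ℕ
rank []      = 0
rank (i ∷ x) = toℕ i + rank x

≼-refl : ∀ {t n} {x : Point t n} → x ≼ x
≼-refl = Pointwise.refl ≤F-refl

rank-mono : ∀ {t n} {x y : Point t n} → x ≼ y → rank x ≤ rank y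
rank-mono []        = z≤n
rank-mono (i≤j ∷ p) = +-mono-≤ i≤j (rank-mono p)

≼∧rank≡⇒≡ : ∀ {t n} {x y : Point t n} → x ≼ y → rank x ≡ rank y → x ≡ y
≼∧rank≡⇒≡ [] _ = refl
≼∧rank≡⇒≡ {x = i ∷ x} {y = j ∷ y} (i≤j ∷ p) e
  with refl ← toℕ-injective (≤-antisym i≤j
         (+-cancelʳ-≤ (rank x) (toℕ j) (toℕ i) (≤-trans (+-monoʳ-≤ (toℕ j) (rank-mono p)) (≤-reflexive (sym e)))))
  = cong (i ∷_) (≼∧rank≡⇒≡ p (+-cancelˡ-≡ (toℕ i) (rank x) (rank y) e))

-- Level sizes

-- A sum of indicators is additive under `_++_` and invariant under `_↭_`, so a level can be counted
-- along the chains as well as along `points`.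
weight : ∀ {t n} → ℕ → ℕ → List (Point t n) → ℕ
weight s k xs = sum (map (λ x → δ (s + rank x) k) xs)

points≡product : ∀ t n → points t (suc n) ≡ cartesianProductWith _∷_ (allFin t) (points t n)
points≡product t n = go (allFin t)
  where
  go : ∀ is → concatMap (λ i → map (i ∷_) (points t n)) is ≡ cartesianProductWith _∷_ is (points t n)
  go []       = refl
  go (i ∷ is) = cong (map (i ∷_) (points t n) ++_) (go is)

weight-points : ∀ t k n s → weight s k (points t n) ≡ W t k n s
weight-points t k zero    s = trans (+-identityʳ _) (cong (λ z → δ z k) (+-identityʳ s))
weight-points t k (suc n) s = trans (cong (weight s k) (points≡product t n)) (go t id (λ i → s + i) (λ _ → refl))
  where
  open ≡-Reasoning
  slice : ∀ i → weight s k (map (i ∷_) (points t n)) ≡ weight (s + toℕ i) k (points t n)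
  slice i = cong sum (trans (sym (map-∘ (points t n)))
    (map-cong (λ x → cong (λ z → δ z k) (sym (+-assoc s (toℕ i) (rank x)))) (points t n)))
  go : ∀ m (f : Fin m → Fin t) (g : ℕ → ℕ) → (∀ i → s + toℕ (f i) ≡ g (toℕ i)) →
       weight s k (cartesianProductWith _∷_ (tabulate f) (points t n)) ≡ ∑ m (λ i → W t k n (g i))
  go zero    f g e = refl
  go (suc m) f g e = begin
    weight s k (map (f fzero ∷_) (points t n) ++ rest)
      ≡⟨ cong sum (map-++ _ (map (f fzero ∷_) (points t n)) rest) ⟩
    sum (map _ (map (f fzero ∷_) (points t n)) ++ map _ rest)
      ≡⟨ sum-++ (map _ (map (f fzero ∷_) (points t n))) (map _ rest) ⟩
    weight s k (map (f fzero ∷_) (points t n)) + weight s k rest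
      ≡⟨ cong₂ _+_ (trans (slice (f fzero)) (trans (weight-points t k n _) (cong (W t k n) (e fzero))))
                   (go m (f ∘ fsuc) (g ∘ suc) (e ∘ fsuc)) ⟩
    W t k n (g 0) + ∑ m (λ i → W t k n (g (suc i))) ∎
    where rest = cartesianProductWith _∷_ (tabulate (f ∘ fsuc)) (points t n)

filter∈sublists : ∀ {A : Set} {P : A → Set} (P? : ∀ x → Dec (P x)) xs → filter P? xs ∈ sublists xs
filter∈sublists P? [] = here refl
filter∈sublists P? (x ∷ xs) with P? x
... | yes _ = ∈-++⁺ʳ (sublists xs) (∈-map⁺ (x ∷_) (filter∈sublists P? xs))
... | no  _ = ∈-++⁺ˡ (filter∈sublists P? xs)

length≤foldr-⊔ : ∀ {A : Set} {S : List A} {Ss} → S ∈ Ss → length S ≤ foldr _⊔_ 0 (map length Ss)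
length≤foldr-⊔ (here refl) = m≤m⊔n _ _
length≤foldr-⊔ (there p)   = ≤-trans (length≤foldr-⊔ p) (m≤n⊔m _ _)

W≤α : ∀ t k n → W t k n 0 ≤ α t n
W≤α t k n = begin
  W t k n 0                    ≡⟨ sym (weight-points t k n 0) ⟩
  weight 0 k (points t n)      ≡⟨ sym (size (points t n)) ⟩
  length level                 ≤⟨ length≤foldr-⊔ (∈-filter⁺ isAntichain? (filter∈sublists rank? (points t n)) antichain) ⟩
  α t n                        ∎
  where
  open ≤-Reasoning
  rank? = λ (x : Point t n) → rank x ≟ k
  level = filter rank? (points t n)
  size : ∀ xs → length (filter rank? xs) ≡ weight 0 k xs
  size [] = refl
  size (x ∷ xs) with rank x ≟ k
  ... | yes p = trans (cong length (filter-accept rank? {x} {xs} p))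
                  (cong₂ _+_ (sym (trans (cong (λ z → δ z k) p) (δ-refl k))) (size xs))
  ... | no ¬p = trans (cong length (filter-reject rank? {x} {xs} ¬p)) (cong₂ _+_ (sym (δ-≢ ¬p)) (size xs))
  antichain : IsAntichain level
  antichain = All.tabulate λ x∈ → All.tabulate λ y∈ x≼y →
    ≼∧rank≡⇒≡ x≼y (trans (proj₂ (∈-filter⁻ rank? {xs = points t n} x∈)) (sym (proj₂ (∈-filter⁻ rank? {xs = points t n} y∈))))

-- Symmetric chain decompositions

product-∷ʳ : ∀ {A B C : Set} (f : A → B → C) xs y ys →
  cartesianProductWith f xs (y ∷ ys) ↭ map (λ x → f x y) xs ++ cartesianProductWith f xs ys
product-∷ʳ f []       y ys = ↭-refl
product-∷ʳ f (x ∷ xs) y ys = prep (f x y) (↭-trans (++⁺ˡ (map (f x) ys) (product-∷ʳ f xs y ys))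
  (shifts (map (f x) ys) (map (λ x → f x y) xs)))

product-flip : ∀ {A B C : Set} (f : A → B → C) xs ys →
  cartesianProductWith f xs ys ↭ cartesianProductWith (flip f) ys xs
product-flip f xs []       = ↭-reflexive (cartesianProductWith-zeroʳ f xs)
product-flip f xs (y ∷ ys) = ↭-trans (product-∷ʳ f xs y ys) (++⁺ˡ (map (λ x → f x y) xs) (product-flip f xs ys))

product-congʳ : ∀ {A B C : Set} (f : A → B → C) xs {ys zs} → ys ↭ zs →
  cartesianProductWith f xs ys ↭ cartesianProductWith f xs zs
product-congʳ f []       p = ↭-refl
product-congʳ f (x ∷ xs) p = ++⁺ (map⁺ (f x) p) (product-congʳ f xs p)

length-product : ∀ {A B C : Set} (f : A → B → C) xs ys → length (cartesianProductWith f xs ys) ≡ length xs * length ys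
length-product f []       ys = refl
length-product f (x ∷ xs) ys = trans (length-++ (map (f x) ys)) (cong₂ _+_ (length-map (f x) ys) (length-product f xs ys))

-- The product of an ascending chain and a descending list ys of coordinates is
-- partitioned into L-shaped chains, each running along the first column and then the top row.
hooks : ∀ {t n} → List (Point t n) → List (Fin t) → List (List (Point t (suc n)))
hooks []       ys       = []
hooks (x ∷ xs) []       = []
hooks (x ∷ xs) (y ∷ ys) = (map (_∷ x) (reverse (y ∷ ys)) ++ map (y ∷_) xs) ∷ hooks xs ys

chains : ∀ t n → List (List (Point t n))
chains t zero    = ([] ∷ []) ∷ []
chains t (suc n) = concatMap (λ c → hooks c (reverse (allFin t))) (chains t n)

concat-hooks : ∀ {t n} (xs : List (Point t n)) ys → concat (hooks xs ys) ↭ cartesianProductWith (flip _∷_) xs ys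
concat-hooks []       ys       = ↭-refl
concat-hooks (x ∷ xs) []       = ↭-reflexive (sym (cartesianProductWith-zeroʳ (flip _∷_) xs))
concat-hooks (x ∷ xs) (y ∷ ys) = begin
  (map (_∷ x) (reverse (y ∷ ys)) ++ map (y ∷_) xs) ++ concat (hooks xs ys)
    ≡⟨ ++-assoc (map (_∷ x) (reverse (y ∷ ys))) _ _ ⟩
  map (_∷ x) (reverse (y ∷ ys)) ++ map (y ∷_) xs ++ concat (hooks xs ys)
    ↭⟨ ++⁺ (map⁺ (_∷ x) (↭-reverse (y ∷ ys))) (++⁺ˡ (map (y ∷_) xs) (concat-hooks xs ys)) ⟩
  map (_∷ x) (y ∷ ys) ++ map (y ∷_) xs ++ cartesianProductWith (flip _∷_) xs ys
    ↭⟨ ++⁺ˡ (map (_∷ x) (y ∷ ys)) (↭-sym (product-∷ʳ (flip _∷_) xs y ys)) ⟩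
  cartesianProductWith (flip _∷_) (x ∷ xs) (y ∷ ys) ∎
  where open PermutationReasoning

concat-chains : ∀ t n → concat (chains t n) ↭ points t n
concat-chains t zero    = ↭-refl
concat-chains t (suc n) = begin
  concat (concatMap (λ c → hooks c ys) (chains t n))                   ↭⟨ go (chains t n) ⟩
  cartesianProductWith (flip _∷_) (concat (chains t n)) ys             ↭⟨ product-congʳ (flip _∷_) (concat (chains t n)) (↭-reverse (allFin t)) ⟩
  cartesianProductWith (flip _∷_) (concat (chains t n)) (allFin t)     ↭⟨ product-flip (flip _∷_) (concat (chains t n)) (allFin t) ⟩
  cartesianProductWith _∷_ (allFin t) (concat (chains t n))            ↭⟨ product-congʳ _∷_ (allFin t) (concat-chains t n) ⟩
  cartesianProductWith _∷_ (allFin t) (points t n)                     ≡⟨ sym (points≡product t n) ⟩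
  points t (suc n)                                                     ∎
  where
  open PermutationReasoning
  ys = reverse (allFin t)
  go : ∀ cs → concat (concatMap (λ c → hooks c ys) cs) ↭ cartesianProductWith (flip _∷_) (concat cs) ys
  go []       = ↭-refl
  go (c ∷ cs) = begin
    concat (hooks c ys ++ concatMap (λ c → hooks c ys) cs)              ≡⟨ sym (concat-++ (hooks c ys) _) ⟩
    concat (hooks c ys) ++ concat (concatMap (λ c → hooks c ys) cs)     ↭⟨ ++⁺ (concat-hooks c ys) (go cs) ⟩
    cartesianProductWith (flip _∷_) c ys ++ cartesianProductWith (flip _∷_) (concat cs) ys
                                                                        ≡⟨ sym (cartesianProductWith-distribʳ-++ (flip _∷_) c (concat cs) ys) ⟩
    cartesianProductWith (flip _∷_) (c ++ concat cs) ys                 ∎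

All-reverse : ∀ {A : Set} {P : A → Set} {xs} → All P xs → All P (reverse xs)
All-reverse {xs = xs} = All-resp-↭ (↭-sym (↭-reverse xs))

AllPairs-reverse : ∀ {A : Set} {R : A → A → Set} {xs} → AllPairs R xs → AllPairs (flip R) (reverse xs)
AllPairs-reverse []                     = []
AllPairs-reverse {xs = x ∷ xs} (px ∷ p) rewrite unfold-reverse x xs =
  AllPairs.++⁺ (AllPairs-reverse p) ([] ∷ []) (All.map (_∷ []) (All-reverse px))

Ascending : ∀ {t n} → List (Point t n) → Set
Ascending = AllPairs _≼_

hooks-ascending : ∀ {t n} {xs : List (Point t n)} {ys} → Ascending xs → AllPairs (flip _≤F_) ys → All Ascending (hooks xs ys)
hooks-ascending []         q          = []
hooks-ascending (px ∷ p)   []         = []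
hooks-ascending {xs = x ∷ xs} {ys = y ∷ ys} (px ∷ p) (qy ∷ q) =
  AllPairs.++⁺ (AllPairs.map⁺ (AllPairs.map (_∷ ≼-refl) (AllPairs-reverse (qy ∷ q))))
    (AllPairs.map⁺ (AllPairs.map (≤F-refl ∷_) p))
    (All.map⁺ (All.map (λ y′≤y → All.map⁺ (All.map (y′≤y ∷_) px)) (All-reverse (≤F-refl ∷ qy))))
  ∷ hooks-ascending p q

chains-ascending : ∀ t n → All Ascending (chains t n)
chains-ascending t zero    = ([] ∷ []) ∷ []
chains-ascending t (suc n) = All.concat⁺ (All.map⁺ (All.map (λ p → hooks-ascending p
  (AllPairs-reverse (AllPairs.tabulate⁺-< <⇒≤))) (chains-ascending t n)))

range : ℕ → ℕ → List ℕ
range r zero    = []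
range r (suc p) = r ∷ range (suc r) p

range-++ : ∀ r p q → range r p ++ range (r + p) q ≡ range r (p + q)
range-++ r zero    q = cong (λ z → range z q) (+-identityʳ r)
range-++ r (suc p) q = cong (r ∷_) (trans (cong (λ z → range (suc r) p ++ range z q) (+-suc r p)) (range-++ (suc r) p q))

map-range : ∀ c r p → map (c +_) (range r p) ≡ range (c + r) p
map-range c r zero    = refl
map-range c r (suc p) = cong (c + r ∷_) (trans (map-range c (suc r) p) (cong (λ z → range z p) (+-suc c r)))

reverse-downFrom-range : ∀ m → reverse (downFrom m) ≡ range 0 m
reverse-downFrom-range zero    = refl
reverse-downFrom-range (suc m) = trans (unfold-reverse m (downFrom m)) (trans (cong (_∷ʳ m) (reverse-downFrom-range m))
  (trans (range-++ 0 m 1) (cong (range 0) (+-comm m 1))))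

-- The condition 2 r + p = N + 1 says that the ranks r, …, r + p − 1 are symmetric about N / 2.
Symmetric : ∀ {t n} → ℕ → List (Point t n) → Set
Symmetric N c = ∃[ r ] ∃[ p ] (map rank c ≡ range r p × 1 ≤ p × r + r + p ≡ suc N)

-- The first hook starts at rank r and has p + m - 1 points. Removing it replaces r, p, m by r + 1,
-- p - 1, m - 1, which preserves 2 r + p + m; hence all hooks share the centre N / 2.
hooks-symmetric : ∀ {t n} (xs : List (Point t n)) (ys : List (Fin t)) r p m N →
  map rank xs ≡ range r p → map toℕ ys ≡ downFrom m → r + r + p + m ≡ suc (suc N) → All (Symmetric N) (hooks xs ys)
hooks-symmetric []       ys       r p m N ex ey eN = []
hooks-symmetric (x ∷ xs) []       r p m N ex ey eN = []
hooks-symmetric {t} {n} (x ∷ xs) (y ∷ ys) r (suc p) (suc m) N ex ey eN =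
  (r , suc m + p , ranks , s≤s z≤n , suc-injective (trans (ring₁ r p m) eN))
  ∷ hooks-symmetric xs ys (suc r) p m N (∷-injectiveʳ ex) (∷-injectiveʳ ey) (trans (ring₂ r p m) eN)
  where
  open ≡-Reasoning
  ring₁ : ∀ r p m → suc (r + r + (suc m + p)) ≡ r + r + suc p + suc m
  ring₁ = solve-∀
  ring₂ : ∀ r p m → suc r + suc r + p + m ≡ r + r + suc p + suc m
  ring₂ = solve-∀
  column : map rank (map (_∷ x) (reverse (y ∷ ys))) ≡ range r (suc m)
  column = begin
    map rank (map (_∷ x) (reverse (y ∷ ys)))           ≡⟨ sym (map-∘ (reverse (y ∷ ys))) ⟩
    map (λ i → toℕ i + rank x) (reverse (y ∷ ys))      ≡⟨ map-cong (λ i → trans (cong (toℕ i +_) (∷-injectiveˡ ex)) (+-comm (toℕ i) r)) (reverse (y ∷ ys)) ⟩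
    map (λ i → r + toℕ i) (reverse (y ∷ ys))           ≡⟨ map-∘ (reverse (y ∷ ys)) ⟩
    map (r +_) (map toℕ (reverse (y ∷ ys)))            ≡⟨ cong (map (r +_)) (trans (reverse-map toℕ (y ∷ ys)) (trans (cong reverse ey) (reverse-downFrom-range (suc m)))) ⟩
    map (r +_) (range 0 (suc m))                       ≡⟨ map-range r 0 (suc m) ⟩
    range (r + 0) (suc m)                              ≡⟨ cong (λ z → range z (suc m)) (+-identityʳ r) ⟩
    range r (suc m)                                    ∎
  row : map rank (map (y ∷_) xs) ≡ range (r + suc m) p
  row = begin
    map rank (map (y ∷_) xs)              ≡⟨ sym (map-∘ xs) ⟩
    map (λ x′ → toℕ y + rank x′) xs       ≡⟨ map-cong (λ x′ → cong (_+ rank x′) (∷-injectiveˡ ey)) xs ⟩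
    map (λ x′ → m + rank x′) xs           ≡⟨ map-∘ xs ⟩
    map (m +_) (map rank xs)              ≡⟨ cong (map (m +_)) (∷-injectiveʳ ex) ⟩
    map (m +_) (range (suc r) p)          ≡⟨ map-range m (suc r) p ⟩
    range (m + suc r) p                   ≡⟨ cong (λ z → range z p) (trans (+-suc m r) (trans (cong suc (+-comm m r)) (sym (+-suc r m)))) ⟩
    range (r + suc m) p                   ∎
  ranks : map rank (map (_∷ x) (reverse (y ∷ ys)) ++ map (y ∷_) xs) ≡ range r (suc m + p)
  ranks = trans (map-++ rank (map (_∷ x) (reverse (y ∷ ys))) (map (y ∷_) xs))
    (trans (cong₂ _++_ column row) (range-++ r (suc m) p))

map-toℕ-reverse-allFin : ∀ t → map toℕ (reverse (allFin t)) ≡ downFrom t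
map-toℕ-reverse-allFin t = begin
  map toℕ (reverse (allFin t))    ≡⟨ reverse-map toℕ (allFin t) ⟩
  reverse (map toℕ (allFin t))    ≡⟨ cong reverse (trans (map-tabulate id toℕ) (go t id)) ⟩
  reverse (upTo t)                ≡⟨ cong reverse (sym (reverse-downFrom t)) ⟩
  reverse (reverse (downFrom t))  ≡⟨ reverse-involutive (downFrom t) ⟩
  downFrom t                      ∎
  where
  open ≡-Reasoning
  go : ∀ m (g : ℕ → ℕ) → tabulate {n = m} (g ∘ toℕ) ≡ applyUpTo g m
  go zero    g = refl
  go (suc m) g = cong (g 0 ∷_) (go m (g ∘ suc))

chains-symmetric : ∀ t n → All (Symmetric (n * t)) (chains (suc t) n)
chains-symmetric t zero    = (0 , 1 , refl , s≤s z≤n , refl) ∷ []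
chains-symmetric t (suc n) = All.concat⁺ (All.map⁺ (All.map
  (λ { (r , p , e , _ , eN) → hooks-symmetric _ _ r p (suc t) (suc n * t) e (map-toℕ-reverse-allFin (suc t))
         (trans (cong (_+ suc t) eN) (cong suc (trans (+-suc (n * t) t) (cong suc (+-comm (n * t) t))))) })
  (chains-symmetric t n)))

1≤range-δ : ∀ r p k → r ≤ k → k < r + p → 1 ≤ sum (map (λ j → δ j k) (range r p))
1≤range-δ r zero    k r≤k k<r+p rewrite +-identityʳ r = contradiction k<r+p (≤⇒≯ r≤k)
1≤range-δ r (suc p) k r≤k k<r+p with r ≟ k
... | yes refl rewrite δ-refl r = s≤s z≤n
... | no  r≢k = ≤-trans (1≤range-δ (suc r) p k (≤∧≢⇒< r≤k r≢k) (subst (k <_) (+-suc r p) k<r+p)) (m≤n+m _ (δ r k))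

-- Since p ≥ 1, the equation 2 r + p = N + 1 gives 2 r ≤ N and N + 2 ≤ 2 (r + p). The rounding in ⌊N
-- / 2⌋ costs at most one, which `double-cancel-≤` absorbs by parity.
symmetric⇒meetsMiddle : ∀ {t n N} {c : List (Point t n)} → Symmetric N c → 1 ≤ weight 0 ⌊ N /2⌋ c
symmetric⇒meetsMiddle {N = N} {c} (r , p , e , 1≤p , eN) =
  subst (λ z → 1 ≤ sum z) (sym (trans (map-∘ c) (cong (map (λ j → δ j ⌊ N /2⌋)) e)))
    (1≤range-δ r p ⌊ N /2⌋ r≤k k<r+p)
  where
  open ≤-Reasoning
  k = ⌊ N /2⌋
  double-cancel-≤ : ∀ {a b} → a + a ≤ suc (b + b) → a ≤ b
  double-cancel-≤ {a} {b} le with a ≤? b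
  ... | yes q = q
  ... | no  q = contradiction (≤-trans (≤-reflexive (cong suc (sym (+-suc b b)))) (≤-trans (+-mono-≤ (≰⇒> q) (≰⇒> q)) le)) (<⇒≱ ≤-refl)
  r≤k : r ≤ k
  r≤k = double-cancel-≤ (begin
    r + r              ≤⟨ ≤-pred (≤-trans (≤-reflexive (+-comm 1 (r + r))) (≤-trans (+-monoʳ-≤ (r + r) 1≤p) (≤-reflexive eN))) ⟩
    N                  ≡⟨ sym (⌊n/2⌋+⌈n/2⌉≡n N) ⟩
    k + _              ≤⟨ +-monoʳ-≤ k (⌈n/2⌉≤1+⌊n/2⌋ N) ⟩
    k + suc k          ≡⟨ +-suc k k ⟩
    suc (k + k)        ∎)
  k<r+p : k < r + p
  k<r+p = double-cancel-≤ (begin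
    suc k + suc k              ≡⟨ cong suc (+-suc k k) ⟩
    suc (suc (k + k))          ≤⟨ s≤s (s≤s (≤-trans (+-monoʳ-≤ k (⌊n/2⌋≤⌈n/2⌉ N)) (≤-reflexive (⌊n/2⌋+⌈n/2⌉≡n N)))) ⟩
    suc (suc N)                ≡⟨ cong suc (sym eN) ⟩
    suc (r + r + p)            ≤⟨ s≤s (m≤m+n (r + r + p) p) ⟩
    suc (r + r + p + p)        ≡⟨ cong suc (ring r p) ⟩
    suc (r + p + (r + p))      ∎)
    where
    ring : ∀ r p → r + r + p + p ≡ r + p + (r + p)
    ring = solve-∀

-- Every chain contributes a point of middle rank, and by `concat-chains` the chains together list
-- each point of the grid once.
length-chains≤ : ∀ t n → length (chains (suc t) n) ≤ W (suc t) ⌊ n * t /2⌋ n 0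
length-chains≤ t n = begin
  length (chains (suc t) n)                        ≤⟨ go (chains-symmetric t n) ⟩
  weight 0 k (concat (chains (suc t) n))           ≡⟨ sum-↭ (map⁺ _ (concat-chains (suc t) n)) ⟩
  weight 0 k (points (suc t) n)                    ≡⟨ weight-points (suc t) k n 0 ⟩
  W (suc t) k n 0                                  ∎
  where
  open ≤-Reasoning
  k = ⌊ n * t /2⌋
  go : ∀ {cs : List (List (Point (suc t) n))} → All (Symmetric (n * t)) cs → length cs ≤ weight 0 k (concat cs)
  go [] = z≤n
  go {c ∷ cs} (p ∷ ps) = begin
    suc (length cs)                          ≤⟨ +-mono-≤ (symmetric⇒meetsMiddle {c = c} p) (go ps) ⟩
    weight 0 k c + weight 0 k (concat cs)    ≡⟨ sym (sum-++ (map _ c) (map _ (concat cs))) ⟩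
    sum (map _ c ++ map _ (concat cs))       ≡⟨ cong sum (sym (map-++ _ c (concat cs))) ⟩
    weight 0 k (c ++ concat cs)              ∎

length-points : ∀ t n → length (points t n) ≡ t ^ n
length-points t zero    = refl
length-points t (suc n) = trans (cong length (points≡product t n))
  (trans (length-product _∷_ (allFin t) (points t n)) (cong₂ _*_ (length-tabulate {n = t} id) (length-points t n)))

-- Encoding down-sets by bits

-- Equal codes yield a relation instead of equality, so that a code for one block need only recover
-- agreement on that block, and codes of several blocks can be concatenated.
Code : (F : Set) → (F → F → Set) → ℕ → Set
Code F R X = Σ[ c ∈ (F → Vec Bool X) ] (∀ D E → c D ≡ c E → R D E)

code-all : ∀ {F I : Set} {R : I → F → F → Set} (is : List I) (X : I → ℕ) → (∀ {i} → i ∈ is → Code F (R i) (X i)) →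
           Code F (λ D E → ∀ {i} → i ∈ is → R i D E) (sum (map X is))
code-all []       X code = (λ _ → []) , λ { _ _ _ () }
code-all {F} {R = R} (i ∷ is) X code = c , sound
  where
  c₁ = code {i} (here refl)
  c₂ = code-all is X (λ j∈ → code (there j∈))
  c : F → Vec Bool (X i + sum (map X is))
  c D = proj₁ c₁ D Vec.++ proj₁ c₂ D
  sound : ∀ D E → c D ≡ c E → ∀ {j} → j ∈ i ∷ is → R j D E
  sound D E e (here refl) = proj₂ c₁ D E (Vec.++-injectiveˡ _ _ e)
  sound D E e (there j∈)  = proj₂ c₂ D E (Vec.++-injectiveʳ (proj₁ c₁ D) (proj₁ c₁ E) e) j∈

Agree : ∀ {F P Q : Set} → (F → P → Q → Bool) → List P → List Q → F → F → Set
Agree mem xs ys D E = ∀ {x y} → x ∈ xs → y ∈ ys → mem D x y ≡ mem E x y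

-- The code follows the boundary of the staircase that a down-set cuts out of
-- xs × ys: at the corner (min xs , max ys), either the whole column of min xs
-- lies inside or the whole row of max ys lies outside.
module _ {F P Q : Set} (_≤₁_ : P → P → Set) (_≤₂_ : Q → Q → Set)
         (≤₁-refl : ∀ {p} → p ≤₁ p) (≤₂-refl : ∀ {q} → q ≤₂ q)
         (mem : F → P → Q → Bool)
         (closed : ∀ D {p p′ q q′} → p ≤₁ p′ → q ≤₂ q′ → mem D p′ q′ ≡ true → mem D p q ≡ true) where

  staircase-corner : ∀ {x y xs ys X} → All (x ≤₁_) xs → All (_≤₂ y) ys →
    Code F (Agree mem xs (y ∷ ys)) X → Code F (Agree mem (x ∷ xs) ys) X → Code F (Agree mem (x ∷ xs) (y ∷ ys)) (suc X)
  staircase-corner {x} {y} {xs} {ys} {X} px qy inside outside = c , sound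
    where
    c : F → Vec Bool (suc X)
    c D = mem D x y ∷ (if mem D x y then proj₁ inside D else proj₁ outside D)
    column : ∀ D {y′} → mem D x y ≡ true → y′ ∈ y ∷ ys → mem D x y′ ≡ true
    column D e y′∈ = closed D ≤₁-refl (All.lookup (≤₂-refl ∷ qy) y′∈) e
    row : ∀ D {x′} → mem D x y ≡ false → x′ ∈ x ∷ xs → mem D x′ y ≡ false
    row D {x′} e x′∈ with mem D x′ y in e′
    ... | false = refl
    ... | true  = trans (sym (closed D (All.lookup (≤₁-refl ∷ px) x′∈) ≤₂-refl e′)) e
    sound : ∀ D E → c D ≡ c E → Agree mem (x ∷ xs) (y ∷ ys) D E
    -- Equal first bits make D and E take the same branch, so the remaining bits are codes for the
    -- same smaller rectangle.
    sound D E e x′∈ y′∈ with mem D x y in eD | mem E x y in eE | Vec.∷-injective e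
    sound D E e (here refl) y′∈  | true  | true  | _        = trans (column D eD y′∈) (sym (column E eE y′∈))
    sound D E e (there x′∈) y′∈  | true  | true  | _ , rest = proj₂ inside D E rest x′∈ y′∈
    sound D E e x′∈ (here refl)  | false | false | _        = trans (row D eD x′∈) (sym (row E eE x′∈))
    sound D E e x′∈ (there y′∈)  | false | false | _ , rest = proj₂ outside D E rest x′∈ y′∈

  staircase : ∀ {xs ys} → AllPairs _≤₁_ xs → AllPairs (flip _≤₂_) ys → Code F (Agree mem xs ys) (length xs + length ys)
  -- With one side exhausted no point remains to be decided; the padding only fixes the code length.
  staircase []       _  = (λ _ → Vec.replicate _ false) , λ { _ _ _ () }
  staircase (_ ∷ _)  [] = (λ _ → Vec.replicate _ false) , λ { _ _ _ _ () }
  staircase {x ∷ xs} {y ∷ ys} (px ∷ p) (qy ∷ q) = staircase-corner px qy (staircase p (qy ∷ q))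
    (subst (Code F (Agree mem (x ∷ xs) ys)) (sym (+-suc (length xs) (length ys))) (staircase (px ∷ p) q))

record DownSet (t n : ℕ) : Set where
  field
    mem    : Point t n → Bool
    closed : ∀ {x y} → x ≼ y → mem y ≡ true → mem x ≡ true

open DownSet

_≗ᴰ_ : ∀ {t n} → DownSet t n → DownSet t n → Set
D ≗ᴰ E = ∀ x → mem D x ≡ mem E x

∈-points : ∀ {t n} (x : Point t n) → x ∈ points t n
∈-points []      = here refl
∈-points (i ∷ x) = ∈-concat⁺′ (∈-map⁺ (i ∷_) (∈-points x)) (∈-map⁺ _ (∈-allFin i))

sum-map-+ : ∀ {I : Set} c (g : I → ℕ) is → sum (map (λ i → c + g i) is) ≡ length is * c + sum (map g is)
sum-map-+ c g []       = refl
sum-map-+ c g (i ∷ is) = trans (cong (c + g i +_) (sum-map-+ c g is)) (ring c (g i) (length is * c) (sum (map g is)))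
  where
  ring : ∀ a b c d → a + b + (c + d) ≡ a + c + (b + d)
  ring = solve-∀

sum-map-* : ∀ {I : Set} k l (g : I → ℕ) is → sum (map (λ i → k * g i + l) is) ≡ k * sum (map g is) + length is * l
sum-map-* k l g []       = cong (_+ 0) (sym (*-zeroʳ k))
sum-map-* k l g (i ∷ is) = trans (cong (k * g i + l +_) (sum-map-* k l g is)) (ring k l (g i) (sum (map g is)) (length is))
  where
  ring : ∀ k l a b c → k * a + l + (k * b + c * l) ≡ k * (a + b) + (l + c * l)
  ring = solve-∀

length-concat : ∀ {A : Set} (xss : List (List A)) → length (concat xss) ≡ sum (map length xss)
length-concat []         = refl
length-concat (xs ∷ xss) = trans (length-++ xs) (cong (length xs +_) (length-concat xss))

∈-chains : ∀ {t n} (x : Point t n) → ∃[ c ] (x ∈ c × c ∈ chains t n)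
∈-chains {t} {n} x = ∈-concat⁻′ (chains t n) (∈-resp-↭ (↭-sym (concat-chains t n)) (∈-points x))

code-downSet : ∀ t a → Code (DownSet t (a + a)) _≗ᴰ_ (2 * (length (chains t a) * t ^ a))
code-downSet t a = subst (Code (DownSet t (a + a)) _≗ᴰ_) size (proj₁ pairs , sound)
  where
  cs = chains t a
  X : List (Point t a) → List (Point t a) → ℕ
  X c d = length c + length d
  concatMem : DownSet t (a + a) → Point t a → Point t a → Bool
  concatMem D x y = mem D (x Vec.++ y)
  concatClosed : ∀ D {x x′ y y′} → x ≼ x′ → y ≼ y′ → concatMem D x′ y′ ≡ true → concatMem D x y ≡ true
  concatClosed D p q = closed D (Pointwise.++⁺ p q)
  -- `staircase` reads its second chain from the top, whence `reverse d`.
  block : ∀ {c d} → c ∈ cs → d ∈ cs → Code (DownSet t (a + a)) (Agree concatMem c (reverse d)) (X c d)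
  block {c} {d} c∈ d∈ = subst (λ l → Code _ (Agree concatMem c (reverse d)) (length c + l)) (length-reverse d)
    (staircase _≼_ _≼_ ≼-refl ≼-refl concatMem concatClosed
      (All.lookup (chains-ascending t a) c∈) (AllPairs-reverse (All.lookup (chains-ascending t a) d∈)))
  pairs = code-all cs (λ c → sum (map (X c) cs)) (λ {c} c∈ → code-all cs (X c) (λ d∈ → block c∈ d∈))
  sound : ∀ D E → proj₁ pairs D ≡ proj₁ pairs E → D ≗ᴰ E
  sound D E e z with Vec.splitAt a z
  ... | x , y , refl with ∈-chains x | ∈-chains y
  ...   | c , x∈c , c∈ | d , y∈d , d∈ = proj₂ pairs D E e c∈ d∈ x∈c (∈-resp-↭ (↭-sym (↭-reverse d)) y∈d)
  open ≡-Reasoning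
  M = length cs
  T = sum (map length cs)
  T≡ : T ≡ t ^ a
  T≡ = trans (sym (length-concat cs)) (trans (↭-length (concat-chains t a)) (length-points t a))
  -- Each chain length is counted once per partner, in either position: twice M times the total
  -- length tᵃ.
  size : sum (map (λ c → sum (map (X c) cs)) cs) ≡ 2 * (M * t ^ a)
  size = begin
    sum (map (λ c → sum (map (X c) cs)) cs)    ≡⟨ cong sum (map-cong (λ c → sum-map-+ (length c) length cs) cs) ⟩
    sum (map (λ c → M * length c + T) cs)      ≡⟨ sum-map-* M T length cs ⟩
    M * T + M * T                              ≡⟨ cong (M * T +_) (sym (+-identityʳ (M * T))) ⟩
    2 * (M * T)                                ≡⟨ cong (λ z → 2 * (M * z)) T≡ ⟩
    2 * (M * t ^ a)                            ∎

code-slices : ∀ t n X → Code (DownSet t n) _≗ᴰ_ X → Code (DownSet t (suc n)) _≗ᴰ_ (t * X)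
code-slices t n X (c , sound) = subst (Code (DownSet t (suc n)) _≗ᴰ_) (trans (size (allFin t)) (cong (_* X) (length-tabulate {n = t} id)))
  (proj₁ slices , λ { D E e (i ∷ x) → proj₂ slices D E e (∈-allFin i) x })
  where
  slice : Fin t → DownSet t (suc n) → DownSet t n
  slice i D = record { mem = λ x → mem D (i ∷ x) ; closed = λ p → closed D (≤F-refl ∷ p) }
  slices = code-all {R = λ i D E → slice i D ≗ᴰ slice i E} (allFin t) (λ _ → X)
    (λ {i} _ → (λ D → c (slice i D)) , (λ D E → sound (slice i D) (slice i E)))
  size : ∀ (is : List (Fin t)) → sum (map (λ _ → X) is) ≡ length is * X
  size []       = refl
  size (i ∷ is) = cong (X +_) (size is)

-- Antichains as down-sets

≼-trans : ∀ {t n} {x y z : Point t n} → x ≼ y → y ≼ z → x ≼ z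
≼-trans = Pointwise.trans ≤F-trans

≼-antisym : ∀ {t n} {x y : Point t n} → x ≼ y → y ≼ x → x ≡ y
≼-antisym p q = ≼∧rank≡⇒≡ p (≤-antisym (rank-mono p) (rank-mono q))

below? : ∀ {t n} (S : List (Point t n)) x → Dec (Any (x ≼_) S)
below? S x = any? (x ≼?_) S

does⇒ : ∀ {P : Set} (P? : Dec P) → does P? ≡ true → P
does⇒ (yes p) _ = p

↓_ : ∀ {t n} → List (Point t n) → DownSet t n
↓ S = record
  { mem    = λ x → does (below? S x)
  ; closed = λ {x} {y} x≼y e → dec-true (below? S x) (Any.map (≼-trans x≼y) (does⇒ (below? S y) e))
  }

-- An s in S lies below some s′ in S′, which lies below some s″ in S. As S is an antichain, s = s″,
-- and antisymmetry gives s = s′.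
↓-⊆ : ∀ {t n} {S S′ : List (Point t n)} → IsAntichain S → (↓ S) ≗ᴰ (↓ S′) → S ⊆ S′
↓-⊆ {S = S} {S′} anti e {s} s∈S
  with s′ , s′∈S′ , s≼s′ ← find (does⇒ (below? S′ s) (trans (sym (e s)) (dec-true (below? S s) (lose s∈S ≼-refl))))
  with s″ , s″∈S , s′≼s″ ← find (does⇒ (below? S s′) (trans (e s′) (dec-true (below? S′ s′) (lose s′∈S′ ≼-refl))))
  with refl ← All.lookup (All.lookup anti s∈S) s″∈S (≼-trans s≼s′ s′≼s″)
  = subst (_∈ S′) (≼-antisym s′≼s″ s≼s′) s′∈S′

∈-sublists⇒⊆ : ∀ {A : Set} (xs : List A) {S} → S ∈ sublists xs → S ⊆ xs
∈-sublists⇒⊆ []       (here refl) ()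
∈-sublists⇒⊆ (x ∷ xs) S∈ y∈ with ∈-++⁻ (sublists xs) S∈
... | inj₁ S∈′ = there (∈-sublists⇒⊆ xs S∈′ y∈)
... | inj₂ S∈′ with ∈-map⁻ (x ∷_) S∈′ | y∈
...   | R , R∈ , refl | here refl = here refl
...   | R , R∈ , refl | there y∈R = there (∈-sublists⇒⊆ xs R∈ y∈R)

sublists-unique : ∀ {A : Set} {xs : List A} → Unique xs → Unique (sublists xs)
sublists-unique []             = [] ∷ []
sublists-unique {xs = x ∷ xs} (px ∷ p) = Unique.++⁺ (sublists-unique p) (Unique.map⁺ (λ { refl → refl }) (sublists-unique p)) disjoint
  where
  disjoint : ∀ {S} → S ∈ sublists xs × S ∈ map (x ∷_) (sublists xs) → ⊥
  disjoint (S∈ , S∈′) with R , _ , refl ← ∈-map⁻ (x ∷_) S∈′ =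
    All.lookup px (∈-sublists⇒⊆ xs S∈ (here refl)) refl

-- Sublists inherit the order of `xs`, so without duplicates membership of the head decides which
-- half of the enumeration a sublist comes from.
sublists-ext : ∀ {A : Set} {xs : List A} {S S′} → Unique xs → S ∈ sublists xs → S′ ∈ sublists xs → S ⊆ S′ → S′ ⊆ S → S ≡ S′
sublists-ext []       (here refl) (here refl) _ _ = refl
sublists-ext {xs = x ∷ xs} (px ∷ p) S∈ S′∈ ⊆₁ ⊆₂ with ∈-++⁻ (sublists xs) S∈ | ∈-++⁻ (sublists xs) S′∈
... | inj₁ q | inj₁ q′ = sublists-ext p q q′ ⊆₁ ⊆₂
... | inj₁ q | inj₂ q′ with R , _ , refl ← ∈-map⁻ (x ∷_) q′ =
  contradiction refl (All.lookup px (∈-sublists⇒⊆ xs q (⊆₂ (here refl))))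
sublists-ext {xs = x ∷ xs} (px ∷ p) S∈ S′∈ ⊆₁ ⊆₂ | inj₂ q | inj₁ q′ with R , _ , refl ← ∈-map⁻ (x ∷_) q =
  contradiction refl (All.lookup px (∈-sublists⇒⊆ xs q′ (⊆₁ (here refl))))
sublists-ext {xs = x ∷ xs} (px ∷ p) S∈ S′∈ ⊆₁ ⊆₂ | inj₂ q | inj₂ q′
  with R , R∈ , refl ← ∈-map⁻ (x ∷_) q | R′ , R′∈ , refl ← ∈-map⁻ (x ∷_) q′ =
  cong (x ∷_) (sublists-ext p R∈ R′∈ (tail R∈ ⊆₁) (tail R′∈ ⊆₂))
  where
  tail : ∀ {R R′} → R ∈ sublists xs → x ∷ R ⊆ x ∷ R′ → R ⊆ R′
  tail R∈ sub y∈ with sub (there y∈)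
  ... | here refl = contradiction refl (All.lookup px (∈-sublists⇒⊆ xs R∈ y∈))
  ... | there y∈′ = y∈′

points-unique : ∀ t n → Unique (points t n)
points-unique t zero    = [] ∷ []
points-unique t (suc n) = subst Unique (sym (points≡product t n))
  (Unique.cartesianProductWith⁺ _∷_ (λ { refl → refl , refl }) (Unique.allFin⁺ t) (points-unique t n))

-- Counting antichains by their codes

bit : Bool → Fin 2
bit true  = fsuc fzero
bit false = fzero

bit-injective : ∀ b c → bit b ≡ bit c → b ≡ c
bit-injective true  true  _ = refl
bit-injective false false _ = refl

bits : ∀ {X} → Vec Bool X → Fin (2 ^ X)
bits []      = fzero
bits (b ∷ v) = combine (bit b) (bits v)

bits-injective : ∀ {X} (v w : Vec Bool X) → bits v ≡ bits w → v ≡ w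
bits-injective []      []      _ = refl
bits-injective (b ∷ v) (c ∷ w) e with combine-injective (bit b) (bits v) (bit c) (bits w) e
... | e₁ , e₂ = cong₂ _∷_ (bit-injective b c e₁) (bits-injective v w e₂)

lookup-injective : ∀ {A : Set} {xs : List A} → Unique xs → ∀ i j → lookup xs i ≡ lookup xs j → i ≡ j
lookup-injective (px ∷ p) fzero    fzero    e = refl
lookup-injective (px ∷ p) fzero    (fsuc j) e = contradiction e (All.lookup px (∈-lookup j))
lookup-injective (px ∷ p) (fsuc i) fzero    e = contradiction (sym e) (All.lookup px (∈-lookup i))
lookup-injective (px ∷ p) (fsuc i) (fsuc j) e = cong fsuc (lookup-injective p i j e)

-- Pigeonhole on positions in the list `antichains t n`: since `A` is the length of that list,
-- injectivity also rests on the list being free of duplicates.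
A≤2^ : ∀ t n {X} → Code (DownSet t n) _≗ᴰ_ X → A t n ≤ 2 ^ X
A≤2^ t n (c , sound) = injective⇒≤ {f = λ i → bits (c (↓ lookup L i))} λ {i} {j} e →
  lookup-injective (Unique.filter⁺ isAntichain? (sublists-unique (points-unique t n))) i j
    (same (∈-lookup i) (∈-lookup j) (sound _ _ (bits-injective _ _ e)))
  where
  L = antichains t n
  same : ∀ {S S′} → S ∈ L → S′ ∈ L → (↓ S) ≗ᴰ (↓ S′) → S ≡ S′
  same S∈ S′∈ e with ∈-filter⁻ isAntichain? {xs = sublists (points t n)} S∈ | ∈-filter⁻ isAntichain? {xs = sublists (points t n)} S′∈
  ... | S∈′ , anti | S′∈′ , anti′ = sublists-ext (points-unique t n) S∈′ S′∈′ (↓-⊆ anti e) (↓-⊆ anti′ (λ x → sym (e x)))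

-- Comparison of the code length with one level

-- Here `w` is the number of slices coded separately: 1 in even dimension, `suc t` in odd dimension.
codeLength≤levels : ∀ t a w → 1 ≤ a → w ≤ suc t →
        w * (2 * (length (chains (suc t) a) * suc t ^ a)) ≤ 512 * ∑ w (W (suc t) (a * t) (a + a))
codeLength≤levels t a w 1≤a w≤ = begin
  w * (2 * (length (chains (suc t) a) * suc t ^ a))   ≤⟨ *-monoʳ-≤ w (*-monoʳ-≤ 2 (*-monoˡ-≤ (suc t ^ a) middle)) ⟩
  w * (2 * (M * suc t ^ a))                           ≡⟨ ring w M (suc t ^ a) ⟩
  2 * (suc t ^ a * M * w)                             ≤⟨ *-monoʳ-≤ 2 (middleLevel-autocorrelation t a w 1≤a w≤) ⟩
  2 * (256 * S)                                       ≡⟨ sym (*-assoc 2 256 S) ⟩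
  512 * S                                             ∎
  where
  open ≤-Reasoning
  M = W (suc t) (a * t) a ⌊ a * t /2⌋
  S = ∑ w (W (suc t) (a * t) (a + a))
  middle : length (chains (suc t) a) ≤ M
  middle = ≤-trans (length-chains≤ t a) (≤-reflexive (W-sym t ⌊ a * t /2⌋ (a * t) a 0 ⌊ a * t /2⌋ refl))
  ring : ∀ w M T → w * (2 * (M * T)) ≡ 2 * (T * M * w)
  ring = solve-∀

A-even : ∀ t a → 1 ≤ a → A (suc t) (a + a) ≤ 2 ^ (512 * α (suc t) (a + a))
A-even t a 1≤a = ≤-trans (A≤2^ (suc t) (a + a) (code-downSet (suc t) a)) (^-monoʳ-≤ 2 (begin
  2 * (length (chains (suc t) a) * suc t ^ a)          ≡⟨ sym (+-identityʳ _) ⟩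
  1 * (2 * (length (chains (suc t) a) * suc t ^ a))    ≤⟨ codeLength≤levels t a 1 1≤a (s≤s z≤n) ⟩
  512 * (W (suc t) (a * t) (a + a) 0 + 0)              ≡⟨ cong (512 *_) (+-identityʳ (W (suc t) (a * t) (a + a) 0)) ⟩
  512 * W (suc t) (a * t) (a + a) 0                    ≤⟨ *-monoʳ-≤ 512 (W≤α (suc t) (a * t) (a + a)) ⟩
  512 * α (suc t) (a + a)                              ∎))
  where open ≤-Reasoning

A-odd : ∀ t a → 1 ≤ a → A (suc t) (suc (a + a)) ≤ 2 ^ (512 * α (suc t) (suc (a + a)))
A-odd t a 1≤a = ≤-trans (A≤2^ (suc t) (suc (a + a)) (code-slices (suc t) (a + a) _ (code-downSet (suc t) a))) (^-monoʳ-≤ 2 (begin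
  suc t * (2 * (length (chains (suc t) a) * suc t ^ a))  ≤⟨ codeLength≤levels t a (suc t) 1≤a ≤-refl ⟩
  -- The sum of `suc t` consecutive shifts is by definition the level of rank `a * t` in one more
  -- dimension.
  512 * W (suc t) (a * t) (suc (a + a)) 0                ≤⟨ *-monoʳ-≤ 512 (W≤α (suc t) (a * t) (suc (a + a))) ⟩
  512 * α (suc t) (suc (a + a))                          ∎))
  where open ≤-Reasoning

halve : ∀ n → ∃[ a ] (n ≡ a + a ⊎ n ≡ suc (a + a))
halve zero          = 0 , inj₁ refl
halve (suc zero)    = 0 , inj₂ refl
halve (suc (suc n)) with halve n
... | a , inj₁ refl = suc a , inj₁ (cong suc (sym (+-suc a a)))
... | a , inj₂ refl = suc a , inj₂ (cong suc (cong suc (sym (+-suc a a))))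

theorem2p1 : ∃[ C ] (∀ (n t : ℕ) → 2 ≤ n → 2 ≤ t → A t n ≤ 2 ^ (C * α t n))
theorem2p1 = 512 , main
  where
  byParity : ∀ {n} t a → n ≡ a + a ⊎ n ≡ suc (a + a) → 2 ≤ n → A (suc t) n ≤ 2 ^ (512 * α (suc t) n)
  byParity t zero    (inj₁ refl) ()
  byParity t zero    (inj₂ refl) (s≤s ())
  byParity t (suc a) (inj₁ refl) _ = A-even t (suc a) (s≤s z≤n)
  byParity t (suc a) (inj₂ refl) _ = A-odd t (suc a) (s≤s z≤n)
  main : ∀ (n t : ℕ) → 2 ≤ n → 2 ≤ t → A t n ≤ 2 ^ (512 * α t n)
  main n (suc t) 2≤n _ = byParity t (proj₁ (halve n)) (proj₂ (halve n)) 2≤n
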